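{- Every tree $T$ satisfies $\mathrm{sfw}(T)\le 4$.
   Context: All graphs are finite, simple and undirected. Split-free cable expressions. A cable is a nonempty set of vertices treated as one indivisible live unit. A split-free cable expression is a typed term; a term of type $p\to q$ receives $p$ ordered live cables and returns $q$ ordered live cables, and its cable rank is $\mathrm{cr}(p\to q)=p+q$. The generators are: $e:1\to1$ (keep one cable unchanged); $\nu_S:0\to1$ (birth a fresh nonempty vertex set $S$ as one cable); $\kappa:1\to0$ (close, i.e. remove, one cable); $\varphi:2\to1$ (fold two cables into their union); $B:2\to2$ (add all edges between the two cables, which both remain live); $K:1\to1$ (add all internal edges of the cable). Terms are combined by serial composition: if $s:p\to q$ and $t:q\to r$ then $s\circ t:p\to r$, where $s$ is performed before $t$; and by parallel product: if $s:p\to q$ and $t:p'\to q'$ then $s\mathbin{\Box}t:p+p'\to q+q'$, which executes the two terms on disjoint vertex sets and concatenates their output cables. Cable permutations are structural reindexings of the ordered interface; they create no vertices or edges and do not change cable rank. The value of a closed expression $t:0\to0$ is the graph on the born vertices whose edges are those added by its block ($B$) and clique ($K$) operations (edge additions use set union). A closed expression is legal for a graph $G$ if every vertex is born exactly once, every added edge belongs to $G$, and the final graph is $G$. The width of an expression is the largest cable rank of a subterm occurrence, where the rank of a subterm is that of its own interface type in the parse tree (so identity wires placed in parallel with a subterm are counted only in the enclosing subterm, not in the subterm itself). $\mathrm{sfw}(G)$ is the minimum width of a legal closed expression for $G$ (value $0$ for the empty graph). -}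

module Defs where

open import Data.Bool using (if_then_else_)
open import Data.Fin using (Fin)
open import Data.Fin.Permutation using (Permutation′; _⟨$⟩ʳ_)
open import Data.Fin.Subset using (Subset; Nonempty; _∈_; _∪_)
open import Data.Fin.Subset.Properties using (_∈?_)
open import Data.List using (List; length; [_])
import Data.List as List
open import Data.List.Relation.Unary.Linked using (Linked)
open import Data.List.Relation.Unary.Unique.Propositional using (Unique)
open import Data.Empty using (⊥)
open import Data.Nat using (ℕ; zero; suc; _+_; _≤_; _⊔_; NonZero)
open import Data.Product using (_×_; ∃-syntax)
open import Data.Sum using (_⊎_)
open import Data.Vec using (Vec; []; _∷_; _++_; take; drop; lookup; tabulate)
open import Level using (0ℓ)
open import Relation.Binary using (Rel; Decidable; Symmetric; Irreflexive)
open import Relation.Binary.Construct.Closure.ReflexiveTransitive using (Star)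
open import Relation.Binary.PropositionalEquality using (_≡_; _≢_)
open import Relation.Nullary using (¬_; does)

record Graph (n : ℕ) : Set₁ where
  field
    Adj    : Rel (Fin n) 0ℓ
    adj?   : Decidable Adj
    sym    : Symmetric Adj
    irrefl : Irreflexive _≡_ Adj

open Graph public using (Adj)

-- The vertices start ∷ rest are the vertices of the cycle in cyclic order.
record Cycle {n : ℕ} (G : Graph n) : Set where
  field
    start    : Fin n
    rest     : List (Fin n)
    long     : 3 ≤ length (start List.∷ rest)
    distinct : Unique (start List.∷ rest)
    linked   : Linked (Adj G) (start List.∷ rest List.++ [ start ])

record IsTree {n : ℕ} (T : Graph n) : Set where
  field
    nonempty  : NonZero n
    connected : ∀ u v → Star (Adj T) u v
    acyclic   : ¬ Cycle T

-- Term n p q: split-free cable expressions of type p → q over the vertices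
-- Fin n.  Permutations are not terms of their own: they reindex the interface
-- of a term, which keeps its type and hence its cable rank.
-- Freshness of births and disjointness of the two factors of _□_ are not
-- enforced here; for closed terms both are part of Legal (bornOnce).
infixl 6 _⨾_
infixl 7 _□_

data Term (n : ℕ) : ℕ → ℕ → Set where
  e       : Term n 1 1
  ν       : (S : Subset n) → Nonempty S → Term n 0 1
  κ       : Term n 1 0
  φ       : Term n 2 1
  B       : Term n 2 2
  K       : Term n 1 1
  _⨾_     : ∀ {p q r} → Term n p q → Term n q r → Term n p r
  _□_     : ∀ {p q p′ q′} → Term n p q → Term n p′ q′ → Term n (p + p′) (q + q′)
  reindex : ∀ {p q} → Permutation′ p → Permutation′ q → Term n p q → Term n p q

cr : ∀ {n p q} → Term n p q → ℕ
cr {p = p} {q = q} _ = p + q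

width : ∀ {n p q} → Term n p q → ℕ
width t@(s ⨾ u)         = cr t ⊔ (width s ⊔ width u)
width t@(s □ u)         = cr t ⊔ (width s ⊔ width u)
width t@(reindex _ _ s) = cr t ⊔ width s
width t                 = cr t

permute : ∀ {a} {A : Set a} {p} → Permutation′ p → Vec A p → Vec A p
permute π xs = tabulate (λ i → lookup xs (π ⟨$⟩ʳ i))

run : ∀ {n p q} → Term n p q → Vec (Subset n) p → Vec (Subset n) q
run e               Cs           = Cs
run (ν S _)         Cs           = S ∷ []
run κ               Cs           = []
run φ               (C ∷ D ∷ []) = C ∪ D ∷ []
run B               Cs           = Cs
run K               Cs           = Cs
run (s ⨾ t)         Cs           = run t (run s Cs)
run (_□_ {p} s t)   Cs           = run s (take p Cs) ++ run t (drop p Cs)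
run (reindex π ρ t) Cs           = permute ρ (run t (permute π Cs))

-- Adds t Cs u v: executing t on the input cables Cs adds the edge uv.
Adds : ∀ {n p q} → Term n p q → Vec (Subset n) p → Rel (Fin n) 0ℓ
Adds B               (C ∷ D ∷ []) u v = (u ∈ C × v ∈ D) ⊎ (u ∈ D × v ∈ C)
Adds K               (C ∷ [])     u v = u ≢ v × u ∈ C × v ∈ C
Adds (s ⨾ t)         Cs           u v = Adds s Cs u v ⊎ Adds t (run s Cs) u v
Adds (_□_ {p} s t)   Cs           u v = Adds s (take p Cs) u v ⊎ Adds t (drop p Cs) u v
Adds (reindex π _ t) Cs           u v = Adds t (permute π Cs) u v
Adds e               _            _ _ = ⊥
Adds (ν _ _)         _            _ _ = ⊥
Adds κ               _            _ _ = ⊥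
Adds φ               _            _ _ = ⊥

births : ∀ {n p q} → Term n p q → Fin n → ℕ
births (ν S _)         v = if does (v ∈? S) then 1 else 0
births (s ⨾ t)         v = births s v + births t v
births (s □ t)         v = births s v + births t v
births (reindex _ _ t) v = births t v
births e               _ = 0
births κ               _ = 0
births φ               _ = 0
births B               _ = 0
births K               _ = 0

-- Given bornOnce, the value of t has vertex set Fin n and edge relation
-- Adds t []; the other two fields say that this graph is G.
record Legal {n : ℕ} (G : Graph n) (t : Term n 0 0) : Set where
  field
    bornOnce : ∀ v → births t v ≡ 1
    sound    : ∀ {u v} → Adds t [] u v → Adj G u v
    complete : ∀ {u v} → Adj G u v → Adds t [] u v

-- IsSfw G w: sfw(G) = w.  A relation rather than a function, since the minimum
-- of a nonempty set of natural numbers is not computable in general.  The empty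
-- graph has no closed expression; its value is 0 by convention.
IsSfw : ∀ {n} → Graph n → ℕ → Set
IsSfw {zero}  G w = w ≡ 0
IsSfw {suc n} G w =
  (∃[ t ] (Legal G t × width t ≡ w)) × (∀ t → Legal G t → w ≤ width t)

-- Upper bound: of a rooted tree only the root stays live, as a singleton cable; a
-- child with its subtree t is joined to s by (s □ t) ⨾ B ⨾ (e □ κ), of width 4.
-- The rooted plane tree needed for this is grown inside T leaf by leaf along
-- paths; acyclicity makes its vertex set induce exactly its own edges.
--
-- Lower bound: for three or more vertices a term of width < 4 has no B, so all
-- edges come from K.  As cables are never split and b is born once, the cables
-- containing b form a chain, hence a K creating ab and a K creating bc also
-- create ac.  A path a b c in T would thus close up to a triangle.
-- For one and two vertices the width is 1 and 2.
module Submission where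

open import Defs
open import Data.Bool using (if_then_else_)
open import Data.Empty using (⊥)
open import Data.Fin using (Fin; zero; suc)
open import Data.Fin.Permutation using (Permutation′; _⟨$⟩ʳ_)
open import Data.Fin.Properties using () renaming (_≟_ to _≟ᶠ_)
open import Data.Fin.Subset using (Subset; _∈_; _∉_; _∪_; ⁅_⁆; ⊤)
open import Data.Fin.Subset.Properties
  using (_∈?_; x∈p∪q⁺; x∈p∪q⁻; x∈⁅x⁆; x∈⁅y⁆⇒x≡y; x≢y⇒x∉⁅y⁆; ∈⊤)
open import Data.List as List using (List; []; _∷_; [_]; length; allFin)
open import Data.List.Membership.Propositional using () renaming (_∈_ to _∈ˡ_)
open import Data.List.Membership.Propositional.Properties using (∈-allFin)
open import Data.List.Membership.DecPropositional using () renaming (_∈?_ to member?)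
open import Data.List.Relation.Unary.All as All using (All; []; _∷_)
open import Data.List.Relation.Unary.All.Properties using (¬Any⇒All¬)
open import Data.List.Relation.Unary.AllPairs using ([]; _∷_)
open import Data.List.Relation.Unary.Any using (here; there)
open import Data.List.Relation.Unary.Linked using (Linked; [-]; _∷_)
open import Data.List.Relation.Unary.Unique.Propositional using (Unique)
open import Data.Nat using (ℕ; zero; suc; _+_; _≤_; z≤n; s≤s; _≟_)
open import Data.Nat.Properties
open import Algebra.Properties.CommutativeMonoid.Sum +-0-commutativeMonoid
  using (sum; sum-cong-≗; sum-permute)
open import Data.Product using (_×_; _,_; proj₁; proj₂; ∃-syntax)
open import Data.Sum using (_⊎_; inj₁; inj₂; map; swap)
open import Data.Unit using () renaming (⊤ to Unit)
open import Data.Vec as Vec using (Vec; []; _∷_; lookup; take; drop)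
open import Data.Vec.Properties using (take++drop≡id; lookup∘tabulate)
open import Data.Vec.Relation.Unary.All as Allᵛ using ([]; _∷_) renaming (All to Allᵛ)
import Data.Vec.Relation.Unary.All.Properties as Allᵛ
open import Function using (_∘_)
open import Relation.Binary using (Rel)
open import Relation.Binary.Construct.Closure.ReflexiveTransitive
  using (Star; ε; _◅_; _◅◅_) renaming (reverse to Star-reverse; map to Star-map)
open import Relation.Binary.PropositionalEquality
  using (_≡_; _≢_; refl; sym; trans; cong; cong₂; subst; module ≡-Reasoning)
open import Relation.Nullary using (¬_; yes; no; does; contradiction)
open import Level using (0ℓ)

private variable
  n p q r p′ q′ : ℕ

-- Occurrences of a vertex among the live cables.

ind : Fin n → Subset n → ℕ
ind v S = if does (v ∈? S) then 1 else 0

ind-∈ : {v : Fin n} {S : Subset n} → v ∈ S → ind v S ≡ 1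
ind-∈ {v = v} {S} v∈S with v ∈? S
... | yes _   = refl
... | no  v∉S = contradiction v∈S v∉S

ind-∉ : {v : Fin n} {S : Subset n} → v ∉ S → ind v S ≡ 0
ind-∉ {v = v} {S} v∉S with v ∈? S
... | yes v∈S = contradiction v∈S v∉S
... | no  _   = refl

ind≡0⇒∉ : {v : Fin n} {S : Subset n} → ind v S ≡ 0 → v ∉ S
ind≡0⇒∉ i≡0 v∈S = 0≢1+n (trans (sym i≡0) (ind-∈ v∈S))

ind-∪ : (v : Fin n) (C D : Subset n) → ind v (C ∪ D) ≤ ind v C + ind v D
ind-∪ v C D with v ∈? (C ∪ D)
... | no  _ = z≤n
... | yes v∈C∪D with x∈p∪q⁻ C D v∈C∪D
...   | inj₁ v∈C rewrite ind-∈ v∈C = s≤s z≤n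
...   | inj₂ v∈D rewrite ind-∈ v∈D = m≤n+m 1 (ind v C)

-- Written as a sum over positions so that invariance of finite sums under permutations settles
-- `reindex`.
count : Fin n → Vec (Subset n) p → ℕ
count v Cs = sum (λ i → ind v (lookup Cs i))

count-++ : (v : Fin n) (Cs : Vec (Subset n) p) (Ds : Vec (Subset n) q) →
           count v (Cs Vec.++ Ds) ≡ count v Cs + count v Ds
count-++ v []       Ds = refl
count-++ v (C ∷ Cs) Ds =
  trans (cong (ind v C +_) (count-++ v Cs Ds)) (sym (+-assoc (ind v C) _ _))

count-take-drop : (v : Fin n) (Cs : Vec (Subset n) (p + q)) →
                  count v Cs ≡ count v (take p Cs) + count v (drop p Cs)
count-take-drop {p = p} v Cs =
  trans (cong (count v) (sym (take++drop≡id p Cs))) (count-++ v (take p Cs) (drop p Cs))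

count-permute : (v : Fin n) (π : Permutation′ p) (Cs : Vec (Subset n) p) →
                count v (permute π Cs) ≡ count v Cs
count-permute v π Cs = trans
  (sum-cong-≗ (λ i → cong (ind v) (lookup∘tabulate (λ j → lookup Cs (π ⟨$⟩ʳ j)) i)))
  (sym (sum-permute (λ i → ind v (lookup Cs i)) π))

count≡0 : (v : Fin n) (Cs : Vec (Subset n) p) → count v Cs ≡ 0 → Allᵛ (v ∉_) Cs
count≡0 v []       _  = []
count≡0 v (C ∷ Cs) eq =
  ind≡0⇒∉ (m+n≡0⇒m≡0 (ind v C) eq) ∷ count≡0 v Cs (m+n≡0⇒n≡0 (ind v C) eq)

module _ {P : Subset n → Set} where

  All-take-drop : (Cs : Vec (Subset n) (p + q)) → Allᵛ P Cs →
                  Allᵛ P (take p Cs) × Allᵛ P (drop p Cs)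
  All-take-drop {p} Cs all =
    Allᵛ.++⁻ (take p Cs) (subst (Allᵛ P) (sym (take++drop≡id p Cs)) all)

  All-permute : (π : Permutation′ p) {Cs : Vec (Subset n) p} →
                Allᵛ P Cs → Allᵛ P (permute π Cs)
  All-permute π {Cs} all = Allᵛ.lookup⁻ λ i →
    subst P (sym (lookup∘tabulate (λ j → lookup Cs (π ⟨$⟩ʳ j)) i)) (Allᵛ.lookup⁺ all (π ⟨$⟩ʳ i))

-- Conservation of vertex copies during execution.

-- Copies of `v` at the disposal of `t`: live at its input or born inside it. For closed terms this
-- is just `births`, and `load ≤ 1` is the form in which being born once passes down to subterms.
load : Term n p q → Vec (Subset n) p → Fin n → ℕ
load t Cs v = count v Cs + births t v

load-⨾ : (s : Term n p q) (t : Term n q r) (Cs : Vec (Subset n) p) (v : Fin n) →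
         load (s ⨾ t) Cs v ≡ load s Cs v + births t v
load-⨾ s t Cs v = sym (+-assoc (count v Cs) _ _)

load-□ : (s : Term n p q) (t : Term n p′ q′) (Cs : Vec (Subset n) (p + p′)) (v : Fin n) →
         load (s □ t) Cs v ≡ load s (take p Cs) v + load t (drop p Cs) v
load-□ {p = p} s t Cs v = begin
  count v Cs + (births s v + births t v)
    ≡⟨ cong (_+ (births s v + births t v)) (count-take-drop {p = p} v Cs) ⟩
  (count v (take p Cs) + count v (drop p Cs)) + (births s v + births t v)
    ≡⟨ +-exchange (count v (take p Cs)) (count v (drop p Cs)) (births s v) (births t v) ⟩
  load s (take p Cs) v + load t (drop p Cs) v ∎
  where
  open ≡-Reasoning
  open import Algebra.Properties.CommutativeSemigroup +-commutativeSemigroup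
    using () renaming (interchange to +-exchange)

load-reindex : (π : Permutation′ p) (ρ : Permutation′ q) (t : Term n p q)
               (Cs : Vec (Subset n) p) (v : Fin n) →
               load (reindex π ρ t) Cs v ≡ load t (permute π Cs) v
load-reindex π ρ t Cs v = cong (_+ births t v) (sym (count-permute v π Cs))

-- No generator duplicates a cable: `φ` merges, `κ` discards, and only `ν` brings new copies.
-- Declared ahead of `load-run`, with which it is mutually recursive through `_⨾_`.
count-run : (t : Term n p q) (Cs : Vec (Subset n) p) (v : Fin n) →
            count v (run t Cs) ≤ load t Cs v

load-run : (s : Term n p q) (t : Term n q r) (Cs : Vec (Subset n) p) (v : Fin n) →
           load t (run s Cs) v ≤ load (s ⨾ t) Cs v
load-run s t Cs v = begin
  load t (run s Cs) v       ≤⟨ +-monoˡ-≤ (births t v) (count-run s Cs v) ⟩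
  load s Cs v + births t v  ≡⟨ load-⨾ s t Cs v ⟨
  load (s ⨾ t) Cs v         ∎
  where open ≤-Reasoning

count-run e               Cs           v = m≤m+n _ 0
count-run (ν S _)         []           v = ≤-reflexive (+-identityʳ (ind v S))
count-run κ               Cs           v = z≤n
count-run φ               (C ∷ D ∷ []) v = begin
  ind v (C ∪ D) + 0              ≡⟨ +-identityʳ _ ⟩
  ind v (C ∪ D)                  ≤⟨ ind-∪ v C D ⟩
  ind v C + ind v D              ≤⟨ +-monoʳ-≤ (ind v C) (m≤m+n _ 0) ⟩
  ind v C + (ind v D + 0)        ≤⟨ m≤m+n _ 0 ⟩
  ind v C + (ind v D + 0) + 0    ∎
  where open ≤-Reasoning
count-run B               Cs           v = m≤m+n _ 0
count-run K               Cs           v = m≤m+n _ 0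
count-run (s ⨾ t)         Cs           v = ≤-trans (count-run t (run s Cs) v) (load-run s t Cs v)
count-run (_□_ {p} s t)   Cs           v = begin
  count v (run s (take p Cs) Vec.++ run t (drop p Cs))       ≡⟨ count-++ v (run s (take p Cs)) _ ⟩
  count v (run s (take p Cs)) + count v (run t (drop p Cs))
    ≤⟨ +-mono-≤ (count-run s (take p Cs) v) (count-run t (drop p Cs) v) ⟩
  load s (take p Cs) v + load t (drop p Cs) v                ≡⟨ load-□ s t Cs v ⟨
  load (s □ t) Cs v                                          ∎
  where open ≤-Reasoning
count-run (reindex π ρ t) Cs           v = begin
  count v (permute ρ (run t (permute π Cs)))  ≡⟨ count-permute v ρ (run t (permute π Cs)) ⟩
  count v (run t (permute π Cs))              ≤⟨ count-run t (permute π Cs) v ⟩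
  load t (permute π Cs) v                     ≡⟨ load-reindex π ρ t Cs v ⟨
  load (reindex π ρ t) Cs v                   ∎
  where open ≤-Reasoning

-- Width forced by the generators that occur.

BFree : Term n p q → Set
BFree B               = ⊥
BFree (s ⨾ t)         = BFree s × BFree t
BFree (s □ t)         = BFree s × BFree t
BFree (reindex _ _ t) = BFree t
BFree _               = Unit

width-⨾ˡ : ∀ {k} (s : Term n p q) (t : Term n q r) → k ≤ width s → k ≤ width (s ⨾ t)
width-⨾ˡ {p = p} {r = r} s t k≤ = m≤n⇒m≤o⊔n (p + r) (m≤n⇒m≤n⊔o (width t) k≤)

width-⨾ʳ : ∀ {k} (s : Term n p q) (t : Term n q r) → k ≤ width t → k ≤ width (s ⨾ t)
width-⨾ʳ {p = p} {r = r} s t k≤ = m≤n⇒m≤o⊔n (p + r) (m≤n⇒m≤o⊔n (width s) k≤)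

width-□ˡ : ∀ {k} (s : Term n p q) (t : Term n p′ q′) → k ≤ width s → k ≤ width (s □ t)
width-□ˡ s t k≤ = m≤n⇒m≤o⊔n (cr (s □ t)) (m≤n⇒m≤n⊔o (width t) k≤)

width-□ʳ : ∀ {k} (s : Term n p q) (t : Term n p′ q′) → k ≤ width t → k ≤ width (s □ t)
width-□ʳ s t k≤ = m≤n⇒m≤o⊔n (cr (s □ t)) (m≤n⇒m≤o⊔n (width s) k≤)

-- A `B` has rank 4 by itself, and the width of a term is at least that of each subterm.
BFree-or-wide : (t : Term n p q) → BFree t ⊎ 4 ≤ width t
BFree-or-wide e       = inj₁ _
BFree-or-wide (ν _ _) = inj₁ _
BFree-or-wide κ       = inj₁ _
BFree-or-wide φ       = inj₁ _
BFree-or-wide B       = inj₂ ≤-refl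
BFree-or-wide K       = inj₁ _
BFree-or-wide (s ⨾ t) with BFree-or-wide s | BFree-or-wide t
... | inj₁ fs | inj₁ ft = inj₁ (fs , ft)
... | inj₂ ws | _       = inj₂ (width-⨾ˡ s t ws)
... | inj₁ _  | inj₂ wt = inj₂ (width-⨾ʳ s t wt)
BFree-or-wide (s □ t) with BFree-or-wide s | BFree-or-wide t
... | inj₁ fs | inj₁ ft = inj₁ (fs , ft)
... | inj₂ ws | _       = inj₂ (width-□ˡ s t ws)
... | inj₁ _  | inj₂ wt = inj₂ (width-□ʳ s t wt)
BFree-or-wide (reindex {p} {q} _ _ t) = map (λ ft → ft) (m≤n⇒m≤o⊔n (p + q)) (BFree-or-wide t)

-- Edges come only from `B`, of rank 4, and `K`, of rank 2. This is the lower bound for two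
-- vertices.
Adds⇒2≤width : (t : Term n p q) (Cs : Vec (Subset n) p) {u v : Fin n} → Adds t Cs u v → 2 ≤ width t
Adds⇒2≤width B                       _  _        = s≤s (s≤s z≤n)
Adds⇒2≤width K                       _  _        = ≤-refl
Adds⇒2≤width (s ⨾ t)                 Cs (inj₁ a) = width-⨾ˡ s t (Adds⇒2≤width s Cs a)
Adds⇒2≤width (s ⨾ t)                 Cs (inj₂ a) = width-⨾ʳ s t (Adds⇒2≤width t _ a)
Adds⇒2≤width (s □ t)                 Cs (inj₁ a) = width-□ˡ s t (Adds⇒2≤width s _ a)
Adds⇒2≤width (s □ t)                 Cs (inj₂ a) = width-□ʳ s t (Adds⇒2≤width t _ a)
Adds⇒2≤width (reindex {p} {q} _ _ t) Cs a        = m≤n⇒m≤o⊔n (p + q) (Adds⇒2≤width t _ a)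

-- Some `ν`, of rank 1, must occur. This is the lower bound for a single vertex.
births⇒1≤width : (t : Term n p q) {v : Fin n} → births t v ≢ 0 → 1 ≤ width t
births⇒1≤width e       b≢0 = contradiction refl b≢0
births⇒1≤width (ν _ _) b≢0 = ≤-refl
births⇒1≤width κ       b≢0 = contradiction refl b≢0
births⇒1≤width φ       b≢0 = contradiction refl b≢0
births⇒1≤width B       b≢0 = contradiction refl b≢0
births⇒1≤width K       b≢0 = contradiction refl b≢0
births⇒1≤width (s ⨾ t) {v} b≢0 with births s v ≟ 0
... | yes s≡0 = width-⨾ʳ s t (births⇒1≤width t λ t≡0 → b≢0 (cong₂ _+_ s≡0 t≡0))
... | no  s≢0 = width-⨾ˡ s t (births⇒1≤width s s≢0)
births⇒1≤width (s □ t) {v} b≢0 with births s v ≟ 0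
... | yes s≡0 = width-□ʳ s t (births⇒1≤width t λ t≡0 → b≢0 (cong₂ _+_ s≡0 t≡0))
... | no  s≢0 = width-□ˡ s t (births⇒1≤width s s≢0)
births⇒1≤width (reindex {p} {q} _ _ t) b≢0 = m≤n⇒m≤o⊔n (p + q) (births⇒1≤width t b≢0)

-- Transitivity of the edges added by terms without `B`.

Adds-sym : (t : Term n p q) (Cs : Vec (Subset n) p) {u v : Fin n} → Adds t Cs u v → Adds t Cs v u
Adds-sym B               (C ∷ D ∷ []) (inj₁ (u∈C , v∈D)) = inj₂ (v∈D , u∈C)
Adds-sym B               (C ∷ D ∷ []) (inj₂ (u∈D , v∈C)) = inj₁ (v∈C , u∈D)
Adds-sym K               (C ∷ [])     (u≢v , u∈C , v∈C)  = u≢v ∘ sym , v∈C , u∈C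
Adds-sym (s ⨾ t)         Cs           a = map (Adds-sym s Cs) (Adds-sym t (run s Cs)) a
Adds-sym (_□_ {p} s t)   Cs           a = map (Adds-sym s (take p Cs)) (Adds-sym t (drop p Cs)) a
Adds-sym (reindex π _ t) Cs           a = Adds-sym t (permute π Cs) a

-- Follows a b Cs: wherever b is live, so is a, in the same cable.
Follows : Fin n → Fin n → Vec (Subset n) p → Set
Follows a b = Allᵛ (λ C → b ∈ C → a ∈ C)

-- Cables are never split, so only a new birth of `b` could place it in a cable lacking `a`;
-- `births t b ≡ 0` rules that out.
Follows-run : (t : Term n p q) (Cs : Vec (Subset n) p) {a b : Fin n} →
              births t b ≡ 0 → Follows a b Cs → Follows a b (run t Cs)
Follows-run e               Cs           _   f = f
Follows-run (ν S _)         Cs           b≡0 f = (λ b∈S → contradiction b∈S (ind≡0⇒∉ b≡0)) ∷ []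
Follows-run κ               Cs           _   f = []
Follows-run φ               (C ∷ D ∷ []) _   (f ∷ g ∷ []) =
  (λ b∈C∪D → x∈p∪q⁺ (map f g (x∈p∪q⁻ C D b∈C∪D))) ∷ []
Follows-run B               Cs           _   f = f
Follows-run K               Cs           _   f = f
Follows-run (s ⨾ t)         Cs {b = b}   b≡0 f =
  Follows-run t (run s Cs) (m+n≡0⇒n≡0 (births s b) b≡0)
    (Follows-run s Cs (m+n≡0⇒m≡0 (births s b) b≡0) f)
Follows-run (_□_ {p} s t)   Cs {b = b}   b≡0 f =
  let fˡ , fʳ = All-take-drop {p = p} Cs f in
  Allᵛ.++⁺ (Follows-run s (take p Cs) (m+n≡0⇒m≡0 (births s b) b≡0) fˡ)
           (Follows-run t (drop p Cs) (m+n≡0⇒n≡0 (births s b) b≡0) fʳ)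
Follows-run (reindex π ρ t) Cs           b≡0 f =
  All-permute ρ (Follows-run t (permute π Cs) b≡0 (All-permute π f))

-- The edge `bc` comes from a `K` on a cable containing `b`, hence also `a`; `a ≢ c` because `K`
-- adds no loops.
Adds-Follows : (t : Term n p q) (Cs : Vec (Subset n) p) {a b c : Fin n} → BFree t → a ≢ c →
               births t b ≡ 0 → Follows a b Cs → Adds t Cs b c → Adds t Cs a c
Adds-Follows K               (C ∷ []) _ a≢c _ (f ∷ []) (_ , b∈C , c∈C) = a≢c , f b∈C , c∈C
Adds-Follows (s ⨾ t) Cs {b = b} (fs , ft) a≢c b≡0 f (inj₁ bc) =
  inj₁ (Adds-Follows s Cs fs a≢c (m+n≡0⇒m≡0 (births s b) b≡0) f bc)
Adds-Follows (s ⨾ t) Cs {b = b} (fs , ft) a≢c b≡0 f (inj₂ bc) =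
  inj₂ (Adds-Follows t (run s Cs) ft a≢c (m+n≡0⇒n≡0 (births s b) b≡0)
         (Follows-run s Cs (m+n≡0⇒m≡0 (births s b) b≡0) f) bc)
Adds-Follows (_□_ {p} s t) Cs {b = b} (fs , ft) a≢c b≡0 f (inj₁ bc) =
  inj₁ (Adds-Follows s (take p Cs) fs a≢c (m+n≡0⇒m≡0 (births s b) b≡0)
         (proj₁ (All-take-drop {p = p} Cs f)) bc)
Adds-Follows (_□_ {p} s t) Cs {b = b} (fs , ft) a≢c b≡0 f (inj₂ bc) =
  inj₂ (Adds-Follows t (drop p Cs) ft a≢c (m+n≡0⇒n≡0 (births s b) b≡0)
         (proj₂ (All-take-drop {p = p} Cs f)) bc)
Adds-Follows (reindex π _ t) Cs ft a≢c b≡0 f bc =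
  Adds-Follows t (permute π Cs) ft a≢c b≡0 (All-permute π f) bc

-- An edge at `b` needs a live copy of `b`. With `load ≤ 1` on the whole term, that copy uses up the
-- budget, so `b` is neither born later nor present in the parallel factor.
Adds⇒1≤load : (t : Term n p q) (Cs : Vec (Subset n) p) {a b : Fin n} →
              Adds t Cs a b → 1 ≤ load t Cs b
Adds⇒1≤load B (C ∷ D ∷ []) (inj₁ (_ , b∈D)) rewrite ind-∈ b∈D = m≤n⇒m≤n+o 0 (m≤n+m 1 _)
Adds⇒1≤load B (C ∷ D ∷ []) (inj₂ (_ , b∈C)) rewrite ind-∈ b∈C = s≤s z≤n
Adds⇒1≤load K (C ∷ []) (_ , _ , b∈C) rewrite ind-∈ b∈C = s≤s z≤n
Adds⇒1≤load (s ⨾ t) Cs {b = b} (inj₁ ab) =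
  ≤-trans (m≤n⇒m≤n+o (births t b) (Adds⇒1≤load s Cs ab)) (≤-reflexive (sym (load-⨾ s t Cs b)))
Adds⇒1≤load (s ⨾ t) Cs {b = b} (inj₂ ab) =
  ≤-trans (Adds⇒1≤load t (run s Cs) ab) (load-run s t Cs b)
Adds⇒1≤load (_□_ {p} s t) Cs {b = b} (inj₁ ab) =
  ≤-trans (m≤n⇒m≤n+o _ (Adds⇒1≤load s (take p Cs) ab)) (≤-reflexive (sym (load-□ s t Cs b)))
Adds⇒1≤load (_□_ {p} s t) Cs {b = b} (inj₂ ab) =
  ≤-trans (m≤n⇒m≤o+n (load s (take p Cs) b) (Adds⇒1≤load t (drop p Cs) ab)) (≤-reflexive (sym (load-□ s t Cs b)))
Adds⇒1≤load (reindex π ρ t) Cs {b = b} ab =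
  ≤-trans (Adds⇒1≤load t (permute π Cs) ab) (≤-reflexive (sym (load-reindex π ρ t Cs b)))

1≤m∧m+n≤1⇒n≡0 : ∀ {m n} → 1 ≤ m → m + n ≤ 1 → n ≡ 0
1≤m∧m+n≤1⇒n≡0 {suc m} {n} _ (s≤s m+n≤0) = m+n≡0⇒n≡0 m (n≤0⇒n≡0 m+n≤0)

module _ (s : Term n p q) (t : Term n q r) (Cs : Vec (Subset n) p) {b : Fin n}
         (once : load (s ⨾ t) Cs b ≤ 1) where

  once-⨾ˡ : load s Cs b ≤ 1
  once-⨾ˡ = m+n≤o⇒m≤o _ (subst (_≤ 1) (load-⨾ s t Cs b) once)

  once-⨾ʳ : load t (run s Cs) b ≤ 1
  once-⨾ʳ = ≤-trans (load-run s t Cs b) once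

  unborn-⨾ʳ : ∀ {a} → Adds s Cs a b → births t b ≡ 0
  unborn-⨾ʳ ab = 1≤m∧m+n≤1⇒n≡0 (Adds⇒1≤load s Cs ab) (subst (_≤ 1) (load-⨾ s t Cs b) once)

module _ (s : Term n p q) (t : Term n p′ q′) (Cs : Vec (Subset n) (p + p′)) {b : Fin n}
         (once : load (s □ t) Cs b ≤ 1) where

  private
    once′ : load s (take p Cs) b + load t (drop p Cs) b ≤ 1
    once′ = subst (_≤ 1) (load-□ s t Cs b) once

  once-□ˡ : load s (take p Cs) b ≤ 1
  once-□ˡ = m+n≤o⇒m≤o _ once′

  once-□ʳ : load t (drop p Cs) b ≤ 1
  once-□ʳ = m+n≤o⇒n≤o (load s (take p Cs) b) once′

  absent-□ʳ : ∀ {a} → Adds s (take p Cs) a b → load t (drop p Cs) b ≡ 0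
  absent-□ʳ ab = 1≤m∧m+n≤1⇒n≡0 (Adds⇒1≤load s (take p Cs) ab) once′

  absent-□ˡ : ∀ {a} → Adds t (drop p Cs) a b → load s (take p Cs) b ≡ 0
  absent-□ˡ ab = 1≤m∧m+n≤1⇒n≡0 (Adds⇒1≤load t (drop p Cs) ab)
    (subst (_≤ 1) (+-comm (load s (take p Cs) b) _) once′)

load≡0⇒Follows : (t : Term n p q) (Cs : Vec (Subset n) p) {a b : Fin n} →
                 load t Cs b ≡ 0 → Follows a b (run t Cs)
load≡0⇒Follows t Cs {b = b} l≡0 = Allᵛ.map (λ b∉C b∈C → contradiction b∈C b∉C)
  (count≡0 b (run t Cs) (n≤0⇒n≡0 (subst (count b (run t Cs) ≤_) l≡0 (count-run t Cs b))))

-- The `K` that adds `ab` sees both ends in one cable; from then on the only copy of `b` carries `a`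
-- along. In a parallel factor the claim is vacuous, as `b` is absent there.
Adds⇒Follows : (t : Term n p q) (Cs : Vec (Subset n) p) {a b : Fin n} → BFree t →
               load t Cs b ≤ 1 → Adds t Cs a b → Follows a b (run t Cs)
Adds⇒Follows K       (C ∷ []) _ _ (_ , a∈C , _) = (λ _ → a∈C) ∷ []
Adds⇒Follows (s ⨾ t) Cs (fs , ft) once (inj₁ ab) =
  Follows-run t (run s Cs) (unborn-⨾ʳ s t Cs once ab)
    (Adds⇒Follows s Cs fs (once-⨾ˡ s t Cs once) ab)
Adds⇒Follows (s ⨾ t) Cs (fs , ft) once (inj₂ ab) =
  Adds⇒Follows t (run s Cs) ft (once-⨾ʳ s t Cs once) ab
Adds⇒Follows (_□_ {p} s t) Cs (fs , ft) once (inj₁ ab) =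
  Allᵛ.++⁺ (Adds⇒Follows s (take p Cs) fs (once-□ˡ s t Cs once) ab)
           (load≡0⇒Follows t (drop p Cs) (absent-□ʳ s t Cs once ab))
Adds⇒Follows (_□_ {p} s t) Cs (fs , ft) once (inj₂ ab) =
  Allᵛ.++⁺ (load≡0⇒Follows s (take p Cs) (absent-□ˡ s t Cs once ab))
           (Adds⇒Follows t (drop p Cs) ft (once-□ʳ s t Cs once) ab)
Adds⇒Follows (reindex π ρ t) Cs {b = b} ft once ab =
  All-permute ρ (Adds⇒Follows t (permute π Cs) ft (subst (_≤ 1) (load-reindex π ρ t Cs b) once) ab)

-- Both edges come from a `K` applied to the cable holding the only copy of `b`. The later of the
-- two cables contains the earlier one, so its `K` also joins `a` to `c`.
Adds-trans : (t : Term n p q) (Cs : Vec (Subset n) p) {a b c : Fin n} → BFree t →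
             load t Cs b ≤ 1 → a ≢ c → Adds t Cs a b → Adds t Cs b c → Adds t Cs a c
Adds-trans K (C ∷ []) _ _ a≢c (_ , a∈C , _) (_ , _ , c∈C) = a≢c , a∈C , c∈C
Adds-trans (s ⨾ t) Cs (fs , ft) once a≢c (inj₁ ab) (inj₁ bc) =
  inj₁ (Adds-trans s Cs fs (once-⨾ˡ s t Cs once) a≢c ab bc)
Adds-trans (s ⨾ t) Cs (fs , ft) once a≢c (inj₂ ab) (inj₂ bc) =
  inj₂ (Adds-trans t (run s Cs) ft (once-⨾ʳ s t Cs once) a≢c ab bc)
Adds-trans (s ⨾ t) Cs (fs , ft) once a≢c (inj₁ ab) (inj₂ bc) =
  inj₂ (Adds-Follows t (run s Cs) ft a≢c (unborn-⨾ʳ s t Cs once ab)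
         (Adds⇒Follows s Cs fs (once-⨾ˡ s t Cs once) ab) bc)
-- Here `bc` is added first, so the roles of `a` and `c` are exchanged by symmetry.
Adds-trans (s ⨾ t) Cs (fs , ft) once a≢c (inj₂ ab) (inj₁ bc) =
  let cb = Adds-sym s Cs bc in
  inj₂ (Adds-sym t (run s Cs)
    (Adds-Follows t (run s Cs) ft (a≢c ∘ sym) (unborn-⨾ʳ s t Cs once cb)
      (Adds⇒Follows s Cs fs (once-⨾ˡ s t Cs once) cb) (Adds-sym t (run s Cs) ab)))
Adds-trans (_□_ {p} s t) Cs (fs , ft) once a≢c (inj₁ ab) (inj₁ bc) =
  inj₁ (Adds-trans s (take p Cs) fs (once-□ˡ s t Cs once) a≢c ab bc)
Adds-trans (_□_ {p} s t) Cs (fs , ft) once a≢c (inj₂ ab) (inj₂ bc) =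
  inj₂ (Adds-trans t (drop p Cs) ft (once-□ʳ s t Cs once) a≢c ab bc)
-- Edges at `b` in both factors would require two copies of `b`.
Adds-trans (_□_ {p} s t) Cs _ once a≢c (inj₁ ab) (inj₂ bc) =
  contradiction (absent-□ʳ s t Cs once ab)
    (n>0⇒n≢0 (Adds⇒1≤load t (drop p Cs) (Adds-sym t (drop p Cs) bc)))
Adds-trans (_□_ {p} s t) Cs _ once a≢c (inj₂ ab) (inj₁ bc) =
  contradiction (absent-□ˡ s t Cs once ab)
    (n>0⇒n≢0 (Adds⇒1≤load s (take p Cs) (Adds-sym s (take p Cs) bc)))
Adds-trans (reindex π ρ t) Cs {b = b} ft once a≢c ab bc =
  Adds-trans t (permute π Cs) ft (subst (_≤ 1) (load-reindex π ρ t Cs b) once) a≢c ab bc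

-- Lower bound for trees with three or more vertices.

triangle : {G : Graph n} {a b c : Fin n} → a ≢ c → Adj G a b → Adj G b c → Adj G c a → Cycle G
triangle {G = G} {a} {b} {c} a≢c ab bc ca = record
  { start    = a
  ; rest     = b ∷ c ∷ []
  ; long     = ≤-refl
  ; distinct = (adj⇒≢ ab ∷ a≢c ∷ []) ∷ (adj⇒≢ bc ∷ []) ∷ [] ∷ []
  ; linked   = ab ∷ bc ∷ ca ∷ [-]
  }
  where
  adj⇒≢ : ∀ {u v} → Adj G u v → u ≢ v
  adj⇒≢ uv u≡v = Graph.irrefl G u≡v uv

path₃⇒4≤width : {T : Graph n} → ¬ Cycle T → {a b c : Fin n} → a ≢ c → Adj T a b → Adj T b c →
                (t : Term n 0 0) → Legal T t → 4 ≤ width t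
path₃⇒4≤width {T = T} acyclic {b = b} a≢c ab bc t legal with BFree-or-wide t
... | inj₂ wide  = wide
... | inj₁ bfree = contradiction (triangle {G = T} a≢c ab bc (Graph.sym T (sound ac))) acyclic
  where
  open Legal legal
  ac = Adds-trans t [] bfree (≤-reflexive (bornOnce b)) a≢c (complete ab) (complete bc)

Path₃ : Graph n → Set
Path₃ T = ∃[ a ] ∃[ b ] ∃[ c ] (a ≢ c × Adj T a b × Adj T b c)

-- The walk must leave the edge `uv`, since `z` is not on it. While it steps back to the other end,
-- the edge is reversed and the walk shortened.
walk⇒Path₃ : (T : Graph n) {u v z : Fin n} → Adj T u v → Star (Adj T) v z →
             z ≢ u → z ≢ v → Path₃ T
walk⇒Path₃ T uv ε z≢u z≢v = contradiction refl z≢v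
walk⇒Path₃ T {u} {v} uv (_◅_ {j = w} vw walk) z≢u z≢v with u ≟ᶠ w
... | no  u≢w  = u , v , w , u≢w , uv , vw
... | yes refl = walk⇒Path₃ T vw walk z≢v z≢u

-- Starts from an edge at vertex 0 and walks to a vertex off that edge: to 2 if its other end is 1,
-- else to 1.
connected⇒Path₃ : (T : Graph (3 + n)) → (∀ u v → Star (Adj T) u v) → Path₃ T
connected⇒Path₃ T connected with connected zero (suc zero)
... | _◅_ {j = x} 0~x _ with x ≟ᶠ suc zero
...   | yes refl = walk⇒Path₃ T 0~x (connected _ (suc (suc zero))) (λ ()) (λ ())
...   | no  x≢1  = walk⇒Path₃ T 0~x (connected x (suc zero)) (λ ()) (x≢1 ∘ sym)

-- Rooted trees and their expressions of width at most 4.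

-- attach s t makes the root of t a child of the root of s.
data RTree (n : ℕ) : Set where
  leaf   : Fin n → RTree n
  attach : RTree n → RTree n → RTree n

root : RTree n → Fin n
root (leaf v)     = v
root (attach s t) = root s

-- A multiplicity rather than a membership predicate, so that it agrees with `births` of the
-- compiled term; membership as a nonzero value is then decidable.
mult : RTree n → Fin n → ℕ
mult (leaf v)     x = ind x ⁅ v ⁆
mult (attach s t) x = mult s x + mult t x

infix 4 _∈ᵗ_ _∉ᵗ_

_∈ᵗ_ _∉ᵗ_ : Fin n → RTree n → Set
x ∉ᵗ t = mult t x ≡ 0
x ∈ᵗ t = ¬ (x ∉ᵗ t)

Joins : Fin n → Fin n → Rel (Fin n) 0ℓ
Joins x y a b = (a ≡ x × b ≡ y) ⊎ (a ≡ y × b ≡ x)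

Edge : RTree n → Rel (Fin n) 0ℓ
Edge (leaf v)     a b = ⊥
Edge (attach s t) a b = (Edge s a b ⊎ Edge t a b) ⊎ Joins (root s) (root t) a b

compile : RTree n → Term n 0 1
compile (leaf v)     = ν ⁅ v ⁆ (v , x∈⁅x⁆ v)
compile (attach s t) = (compile s □ compile t) ⨾ B ⨾ (e □ κ)

-- This invariant is why each `B` adds just the edge between two roots.
run-compile : (t : RTree n) → run (compile t) [] ≡ ⁅ root t ⁆ ∷ []
run-compile (leaf v)     = refl
run-compile (attach s t) rewrite run-compile s = refl

births-compile : (t : RTree n) (x : Fin n) → births (compile t) x ≡ mult t x
births-compile (leaf v)     x = refl
births-compile (attach s t) x =
  trans (trans (+-identityʳ _) (+-identityʳ _)) (cong₂ _+_ (births-compile s x) (births-compile t x))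

Adds-compile⇒Edge : (t : RTree n) {a b : Fin n} → Adds (compile t) [] a b → Edge t a b
Adds-compile⇒Edge (attach s t) (inj₁ (inj₁ ab)) =
  inj₁ (map (Adds-compile⇒Edge s) (Adds-compile⇒Edge t) ab)
Adds-compile⇒Edge (attach s t) (inj₁ (inj₂ ab)) rewrite run-compile s | run-compile t =
  inj₂ (map (λ (a∈ , b∈) → x∈⁅y⁆⇒x≡y _ a∈ , x∈⁅y⁆⇒x≡y _ b∈)
            (λ (a∈ , b∈) → x∈⁅y⁆⇒x≡y _ a∈ , x∈⁅y⁆⇒x≡y _ b∈) ab)
Adds-compile⇒Edge (attach s t) (inj₂ (inj₁ ()))
Adds-compile⇒Edge (attach s t) (inj₂ (inj₂ ()))

Edge⇒Adds-compile : (t : RTree n) {a b : Fin n} → Edge t a b → Adds (compile t) [] a b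
Edge⇒Adds-compile (attach s t) (inj₁ ab) =
  inj₁ (inj₁ (map (Edge⇒Adds-compile s) (Edge⇒Adds-compile t) ab))
Edge⇒Adds-compile (attach s t) (inj₂ ab) rewrite run-compile s | run-compile t =
  inj₁ (inj₂ (map (λ { (refl , refl) → x∈⁅x⁆ _ , x∈⁅x⁆ _ })
                  (λ { (refl , refl) → x∈⁅x⁆ _ , x∈⁅x⁆ _ }) ab))

width-compile : (t : RTree n) → width (compile t) ≤ 4
width-compile (leaf v)     = s≤s z≤n
width-compile (attach s t) =
  ⊔-lub (s≤s z≤n)
    -- Only `B` itself is tight here; `e □ κ` has rank 3, and the interfaces 0 → 1 and 0 → 2 have
    -- ranks 1 and 2.
    (⊔-lub (⊔-lub 2≤4 (⊔-lub (⊔-lub 2≤4 (⊔-lub (width-compile s) (width-compile t))) ≤-refl))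
           (n≤1+n 3))
  where
  2≤4 : 2 ≤ 4
  2≤4 = s≤s (s≤s z≤n)

∈ᵗ-root : (t : RTree n) → root t ∈ᵗ t
∈ᵗ-root (leaf v)     v∉ = ind≡0⇒∉ v∉ (x∈⁅x⁆ v)
∈ᵗ-root (attach s t) r∉ = ∈ᵗ-root s (m+n≡0⇒m≡0 _ r∉)

∈ᵗ-leaf : (x v : Fin n) → x ∈ᵗ leaf v → x ≡ v
∈ᵗ-leaf x v x∈ with x ≟ᶠ v
... | yes x≡v = x≡v
... | no  x≢v = contradiction (ind-∉ (x≢y⇒x∉⁅y⁆ x≢v)) x∈

∈ᵗ-attachˡ : (s t : RTree n) {x : Fin n} → x ∈ᵗ s → x ∈ᵗ attach s t
∈ᵗ-attachˡ s t x∈s x∉ = x∈s (m+n≡0⇒m≡0 _ x∉)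

∈ᵗ-attachʳ : (s t : RTree n) {x : Fin n} → x ∈ᵗ t → x ∈ᵗ attach s t
∈ᵗ-attachʳ s t {x} x∈t x∉ = x∈t (m+n≡0⇒n≡0 (mult s x) x∉)

∈ᵗ-attach⁻ : (s t : RTree n) {x : Fin n} → x ∉ᵗ s → x ∈ᵗ attach s t → x ∈ᵗ t
∈ᵗ-attach⁻ s t x∉s x∈ x∉t = x∈ (cong₂ _+_ x∉s x∉t)

Edge-sym : (t : RTree n) {a b : Fin n} → Edge t a b → Edge t b a
Edge-sym (attach s t) (inj₁ ab) = inj₁ (map (Edge-sym s) (Edge-sym t) ab)
Edge-sym (attach s t) (inj₂ ab) = inj₂ (swap (map (λ (p , q) → q , p) (λ (p , q) → q , p) ab))

Edge⇒∈ᵗ : (t : RTree n) {a b : Fin n} → Edge t a b → b ∈ᵗ t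
Edge⇒∈ᵗ (attach s t) (inj₁ (inj₁ ab))          = ∈ᵗ-attachˡ s t (Edge⇒∈ᵗ s ab)
Edge⇒∈ᵗ (attach s t) (inj₁ (inj₂ ab))          = ∈ᵗ-attachʳ s t (Edge⇒∈ᵗ t ab)
Edge⇒∈ᵗ (attach s t) (inj₂ (inj₁ (_ , refl)))  = ∈ᵗ-attachʳ s t (∈ᵗ-root t)
Edge⇒∈ᵗ (attach s t) (inj₂ (inj₂ (_ , refl)))  = ∈ᵗ-attachˡ s t (∈ᵗ-root s)

root⟶∗ : (t : RTree n) {x : Fin n} → x ∈ᵗ t → Star (Edge t) (root t) x
root⟶∗ (leaf v) {x} x∈ with refl ← ∈ᵗ-leaf x v x∈ = ε
root⟶∗ (attach s t) {x} x∈ with mult s x ≟ 0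
... | no  x∈s = Star-map (inj₁ ∘ inj₁) (root⟶∗ s x∈s)
... | yes x∉s = inj₂ (inj₁ (refl , refl)) ◅
                Star-map (inj₁ ∘ inj₂) (root⟶∗ t (∈ᵗ-attach⁻ s t x∉s x∈))

-- Up to the root and down again.
Edge-connected : (t : RTree n) {x y : Fin n} → x ∈ᵗ t → y ∈ᵗ t → Star (Edge t) x y
Edge-connected t x∈ y∈ = Star-reverse (Edge-sym t) (root⟶∗ t x∈) ◅◅ root⟶∗ t y∈

-- Adding a leaf to a rooted tree.

-- For u ∉ᵗ t the new leaf still goes somewhere, so that mult-graft and
-- root-graft need no hypothesis.
graft : Fin n → Fin n → RTree n → RTree n
graft w u (leaf v)     = attach (leaf v) (leaf w)
graft w u (attach s t) with mult s u ≟ 0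
... | no  _ = attach (graft w u s) t
... | yes _ = attach s (graft w u t)

root-graft : (w u : Fin n) (t : RTree n) → root (graft w u t) ≡ root t
root-graft w u (leaf v)     = refl
root-graft w u (attach s t) with mult s u ≟ 0
... | no  _ = root-graft w u s
... | yes _ = refl

mult-graft : (w u : Fin n) (t : RTree n) (x : Fin n) →
             mult (graft w u t) x ≡ mult t x + ind x ⁅ w ⁆
mult-graft w u (leaf v)     x = refl
mult-graft w u (attach s t) x with mult s u ≟ 0
... | no  _ = trans (cong (_+ mult t x) (mult-graft w u s x)) (+-xy∙z≈xz∙y (mult s x) _ _)
  where
  open import Algebra.Properties.CommutativeSemigroup +-commutativeSemigroup
    using () renaming (xy∙z≈xz∙y to +-xy∙z≈xz∙y)
... | yes _ = trans (cong (mult s x +_) (mult-graft w u t x)) (sym (+-assoc (mult s x) _ _))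

-- Grafting keeps the roots of all subtrees, hence the old joining edges; with `Edge-graft⁺` it
-- follows that exactly `uw` is added.
Edge-graft⁻ : (w u : Fin n) (t : RTree n) → u ∈ᵗ t → {a b : Fin n} →
              Edge (graft w u t) a b → Edge t a b ⊎ Joins u w a b
Edge-graft⁻ w u (leaf v) u∈ (inj₁ (inj₁ ()))
Edge-graft⁻ w u (leaf v) u∈ (inj₁ (inj₂ ()))
Edge-graft⁻ w u (leaf v) u∈ (inj₂ ab) with refl ← ∈ᵗ-leaf u v u∈ = inj₂ ab
Edge-graft⁻ w u (attach s t) u∈ ab with mult s u ≟ 0
Edge-graft⁻ w u (attach s t) u∈ (inj₁ (inj₁ ab)) | no u∈s =
  map (inj₁ ∘ inj₁) (λ j → j) (Edge-graft⁻ w u s u∈s ab)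
Edge-graft⁻ w u (attach s t) u∈ (inj₁ (inj₂ ab)) | no u∈s = inj₁ (inj₁ (inj₂ ab))
Edge-graft⁻ w u (attach s t) u∈ (inj₂ ab)        | no u∈s rewrite root-graft w u s =
  inj₁ (inj₂ ab)
Edge-graft⁻ w u (attach s t) u∈ (inj₁ (inj₁ ab)) | yes u∉s = inj₁ (inj₁ (inj₁ ab))
Edge-graft⁻ w u (attach s t) u∈ (inj₁ (inj₂ ab)) | yes u∉s =
  map (inj₁ ∘ inj₂) (λ j → j) (Edge-graft⁻ w u t (∈ᵗ-attach⁻ s t u∉s u∈) ab)
Edge-graft⁻ w u (attach s t) u∈ (inj₂ ab)        | yes u∉s rewrite root-graft w u t =
  inj₁ (inj₂ ab)

Edge-graft⁺ : (w u : Fin n) (t : RTree n) → u ∈ᵗ t → {a b : Fin n} →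
              Edge t a b ⊎ Joins u w a b → Edge (graft w u t) a b
Edge-graft⁺ w u (leaf v) u∈ (inj₂ ab) with refl ← ∈ᵗ-leaf u v u∈ = inj₂ ab
Edge-graft⁺ w u (attach s t) u∈ ab with mult s u ≟ 0
Edge-graft⁺ w u (attach s t) u∈ (inj₁ (inj₁ (inj₁ ab))) | no u∈s =
  inj₁ (inj₁ (Edge-graft⁺ w u s u∈s (inj₁ ab)))
Edge-graft⁺ w u (attach s t) u∈ (inj₁ (inj₁ (inj₂ ab))) | no u∈s = inj₁ (inj₂ ab)
Edge-graft⁺ w u (attach s t) u∈ (inj₁ (inj₂ ab))        | no u∈s rewrite root-graft w u s =
  inj₂ ab
Edge-graft⁺ w u (attach s t) u∈ (inj₂ ab)               | no u∈s =
  inj₁ (inj₁ (Edge-graft⁺ w u s u∈s (inj₂ ab)))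
Edge-graft⁺ w u (attach s t) u∈ (inj₁ (inj₁ (inj₁ ab))) | yes u∉s = inj₁ (inj₁ ab)
Edge-graft⁺ w u (attach s t) u∈ (inj₁ (inj₁ (inj₂ ab))) | yes u∉s =
  inj₁ (inj₂ (Edge-graft⁺ w u t (∈ᵗ-attach⁻ s t u∉s u∈) (inj₁ ab)))
Edge-graft⁺ w u (attach s t) u∈ (inj₁ (inj₂ ab))        | yes u∉s rewrite root-graft w u t =
  inj₂ ab
Edge-graft⁺ w u (attach s t) u∈ (inj₂ ab)               | yes u∉s =
  inj₁ (inj₂ (Edge-graft⁺ w u t (∈ᵗ-attach⁻ s t u∉s u∈) (inj₂ ab)))

-- Simple paths.

-- The index lists the visited vertices, both ends included, so a path is simple when this list is
-- `Unique`.
data Path {A : Set} (R : Rel A 0ℓ) : A → A → List A → Set where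
  end  : ∀ {x} → Path R x x [ x ]
  step : ∀ {x y z l} → R x y → Path R y z l → Path R x z (x ∷ l)

module _ {A : Set} {R : Rel A 0ℓ} where

  Path-suffix : ∀ {x y z l} → Path R y z l → Unique l → x ∈ˡ l →
                ∃[ l′ ] (Path R x z l′ × Unique l′)
  Path-suffix end        uniq       (here refl) = _ , end , uniq
  Path-suffix (step r p) uniq       (here refl) = _ , step r p , uniq
  Path-suffix (step _ p) (_ ∷ uniq) (there x∈l) = Path-suffix p uniq x∈l

  Path⇒All : ∀ {P : A → Set} {x z l} → (∀ {a b} → R a b → P b) → P x → Path R x z l → All P l
  Path⇒All R⇒P px end        = px ∷ []
  Path⇒All R⇒P px (step r p) = px ∷ Path⇒All R⇒P (R⇒P r) p

  2≤length-Path : ∀ {x z l} → x ≢ z → Path R x z l → 2 ≤ length l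
  2≤length-Path x≢z end                 = contradiction refl x≢z
  2≤length-Path x≢z (step _ end)        = ≤-refl
  2≤length-Path x≢z (step _ (step _ p)) = s≤s (s≤s z≤n)

  -- With `v` equal to `w` this closes a path into a cycle; they are kept apart because the
  -- induction moves `v` along the path.
  Path⇒Linked : ∀ {Q : Rel A 0ℓ} {v x z w l} → (∀ {a b} → R a b → Q a b) →
                Q v x → Path R x z l → Q z w → Linked Q (v ∷ l List.++ [ w ])
  Path⇒Linked R⇒Q vx end        zw = vx ∷ zw ∷ [-]
  Path⇒Linked R⇒Q vx (step r p) zw = vx ∷ Path⇒Linked R⇒Q (R⇒Q r) p zw

-- Loop erasure: if `x` recurs on the simple path already found, everything before that occurrence
-- is dropped.
Star⇒simple-Path : {R : Rel (Fin n) 0ℓ} {x z : Fin n} → Star R x z →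
                   ∃[ l ] (Path R x z l × Unique l)
Star⇒simple-Path ε = _ , end , [] ∷ []
Star⇒simple-Path {x = x} (r ◅ rs) with Star⇒simple-Path rs
... | l , p , uniq with member? _≟ᶠ_ x l
...   | yes x∈l = Path-suffix p uniq x∈l
...   | no  x∉l = x ∷ l , step r p , ¬Any⇒All¬ l x∉l ∷ uniq

-- Growing a spanning rooted tree inside an acyclic connected graph.

-- The invariant of the growth. Once `t` spans `G`, `Adj⇒Edge` says that no edge of `G` is missed.
record Induces (G : Graph n) (t : RTree n) : Set where
  field
    mult≤1   : ∀ x → mult t x ≤ 1
    Edge⇒Adj : ∀ {a b} → Edge t a b → Adj G a b
    Adj⇒Edge : ∀ {a b} → a ∈ᵗ t → b ∈ᵗ t → Adj G a b → Edge t a b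

Induces-leaf : (G : Graph n) (v : Fin n) → Induces G (leaf v)
Induces-leaf G v = record
  { mult≤1   = mult≤1
  ; Edge⇒Adj = λ ()
  ; Adj⇒Edge = λ {a} {b} a∈ b∈ ab → Graph.irrefl G (trans (∈ᵗ-leaf a v a∈) (sym (∈ᵗ-leaf b v b∈))) ab
  }
  where
  mult≤1 : ∀ x → ind x ⁅ v ⁆ ≤ 1
  mult≤1 x with x ∈? ⁅ v ⁆
  ... | yes _ = ≤-refl
  ... | no  _ = z≤n

module _ {T : Graph n} (acyclic : ¬ Cycle T) where

  -- Two distinct neighbours of `w` in `t` would be joined by a simple path within `t`; it avoids
  -- `w`, so going through `w` closes it into a cycle.
  unique-neighbour : {t : RTree n} → Induces T t → {u w x : Fin n} → w ∉ᵗ t →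
                     u ∈ᵗ t → x ∈ᵗ t → Adj T u w → Adj T x w → u ≡ x
  unique-neighbour {t} I {u} {w} {x} w∉ u∈ x∈ uw xw with u ≟ᶠ x
  ... | yes u≡x = u≡x
  ... | no  u≢x with Star⇒simple-Path (Edge-connected t u∈ x∈)
  ...   | l , p , uniq = contradiction cycle acyclic
    where
    cycle : Cycle T
    cycle = record
      { start    = w
      ; rest     = l
      ; long     = s≤s (2≤length-Path u≢x p)
      ; distinct = All.map (λ { y∈ refl → y∈ w∉ }) (Path⇒All (Edge⇒∈ᵗ t) u∈ p) ∷ uniq
      ; linked   = Path⇒Linked (Induces.Edge⇒Adj I) (Graph.sym T uw) p xw
      }

  -- By `unique-neighbour`, `u` is the only neighbour of `w` in `t`, so the one new edge is all that
  -- the induced subgraph gains.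
  Induces-graft : {t : RTree n} → Induces T t → {u w : Fin n} → w ∉ᵗ t → u ∈ᵗ t →
                  Adj T u w → Induces T (graft w u t)
  Induces-graft {t} induces {u} {w} w∉ u∈ uw = record
    { mult≤1   = λ x → subst (_≤ 1) (sym (mult-graft w u t x)) (mult≤1′ x)
    ; Edge⇒Adj = λ ab → edge⇒adj (Edge-graft⁻ w u t u∈ ab)
    ; Adj⇒Edge = λ a∈ b∈ ab → Edge-graft⁺ w u t u∈ (adj⇒edge (∈-graft⁻ a∈) (∈-graft⁻ b∈) ab)
    }
    where
    open Induces induces

    mult≤1′ : ∀ x → mult t x + ind x ⁅ w ⁆ ≤ 1
    mult≤1′ x with x ≟ᶠ w
    ... | yes refl rewrite w∉ = Induces.mult≤1 (Induces-leaf T w) w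
    ... | no  x≢w rewrite ind-∉ (x≢y⇒x∉⁅y⁆ x≢w) | +-identityʳ (mult t x) = mult≤1 x

    edge⇒adj : ∀ {a b} → Edge t a b ⊎ Joins u w a b → Adj T a b
    edge⇒adj (inj₁ ab)                   = Edge⇒Adj ab
    edge⇒adj (inj₂ (inj₁ (refl , refl))) = uw
    edge⇒adj (inj₂ (inj₂ (refl , refl))) = Graph.sym T uw

    ∈-graft⁻ : ∀ {x} → x ∈ᵗ graft w u t → x ≡ w ⊎ x ∈ᵗ t
    ∈-graft⁻ {x} x∈ with x ≟ᶠ w
    ... | yes x≡w = inj₁ x≡w
    ... | no  x≢w = inj₂ λ x∉ →
      x∈ (trans (mult-graft w u t x) (cong₂ _+_ x∉ (ind-∉ (x≢y⇒x∉⁅y⁆ x≢w))))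

    adj⇒edge : ∀ {a b} → a ≡ w ⊎ a ∈ᵗ t → b ≡ w ⊎ b ∈ᵗ t → Adj T a b →
               Edge t a b ⊎ Joins u w a b
    adj⇒edge (inj₁ refl) (inj₁ refl) ab = contradiction ab (Graph.irrefl T refl)
    adj⇒edge (inj₁ refl) (inj₂ b∈)   ab =
      inj₂ (inj₂ (refl , sym (unique-neighbour induces w∉ u∈ b∈ uw (Graph.sym T ab))))
    adj⇒edge (inj₂ a∈)   (inj₁ refl) ab =
      inj₂ (inj₁ (sym (unique-neighbour induces w∉ u∈ a∈ uw ab) , refl))
    adj⇒edge (inj₂ a∈)   (inj₂ b∈)   ab = inj₁ (Adj⇒Edge a∈ b∈ ab)

  Extension : RTree n → (Fin n → Set) → Set
  Extension t P = ∃[ t′ ] (Induces T t′ × (∀ {x} → x ∈ᵗ t → x ∈ᵗ t′) × (∀ {x} → P x → x ∈ᵗ t′))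

  -- The walk is absorbed from its end at `r` backwards, so when `v` is reached its successor is
  -- already in the tree and can carry it as a leaf.
  extend-along : {t : RTree n} → Induces T t → {v r : Fin n} → r ∈ᵗ t → Star (Adj T) v r →
                 Extension t (_≡ v)
  extend-along {t} I r∈ ε = t , I , (λ x∈ → x∈) , λ { refl → r∈ }
  extend-along {t} I {v} r∈ (_◅_ {j = u} vu walk) with extend-along I r∈ walk
  ... | t′ , I′ , ⊆t′ , u∈ with mult t′ v ≟ 0
  ...   | no  v∈ = t′ , I′ , ⊆t′ , λ { refl → v∈ }
  ...   | yes v∉ =
    graft v u t′ , Induces-graft I′ v∉ (u∈ refl) (Graph.sym T vu) ,
    (λ {x} x∈ x∉ → ⊆t′ x∈ (m+n≡0⇒m≡0 _ (trans (sym (mult-graft v u t′ x)) x∉))) ,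
    λ { refl v∉′ → ind≡0⇒∉ (m+n≡0⇒n≡0 (mult t′ v) (trans (sym (mult-graft v u t′ v)) v∉′)) (x∈⁅x⁆ v) }

  extend-over : (∀ u v → Star (Adj T) u v) → {t : RTree n} → Induces T t → (l : List (Fin n)) →
                Extension t (_∈ˡ l)
  extend-over connected {t} I []      = t , I , (λ x∈ → x∈) , λ ()
  extend-over connected {t} I (v ∷ l) with extend-over connected I l
  -- Any vertex of `t₁` would do as the target of the walk; the root is at hand.
  ... | t₁ , I₁ , ⊆t₁ , l⊆t₁ with extend-along I₁ (∈ᵗ-root t₁) (connected v (root t₁))
  ...   | t₂ , I₂ , t₁⊆t₂ , v∈ =
    t₂ , I₂ , t₁⊆t₂ ∘ ⊆t₁ , λ { (here refl) → v∈ refl ; (there x∈) → t₁⊆t₂ (l⊆t₁ x∈) }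

spanning : (T : Graph (suc n)) → IsTree T → ∃[ t ] (Induces T t × (∀ x → x ∈ᵗ t))
spanning T tree with extend-over acyclic connected (Induces-leaf T zero) (allFin _)
  where open IsTree tree
... | t , induces , _ , all∈ = t , induces , λ x → all∈ (∈-allFin x)

legal-compile : {T : Graph n} (t : RTree n) → Induces T t → (∀ x → x ∈ᵗ t) →
                Legal T (compile t ⨾ κ)
legal-compile t induces all∈ = record
  { bornOnce = λ x → trans (+-identityʳ _) (trans (births-compile t x)
                       (≤-antisym (mult≤1 x) (n≢0⇒n>0 (all∈ x))))
  ; sound    = λ { (inj₁ ab) → Edge⇒Adj (Adds-compile⇒Edge t ab) }
  ; complete = λ ab → inj₁ (Edge⇒Adds-compile t (Adj⇒Edge (all∈ _) (all∈ _) ab))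
  }
  where open Induces induces

-- Exact values by number of vertices.

IsSfw-one : (T : Graph 1) → IsSfw T 1
IsSfw-one T = (ν ⊤ (zero , ∈⊤) ⨾ κ , legal , refl) , λ t l →
  births⇒1≤width t {zero} λ b≡0 → 0≢1+n (trans (sym b≡0) (Legal.bornOnce l zero))
  where
  legal : Legal T (ν ⊤ (zero , ∈⊤) ⨾ κ)
  legal = record
    { bornOnce = λ { zero → refl }
    ; sound    = λ { (inj₁ ()) ; (inj₂ ()) }
    ; complete = λ { {zero} {zero} uv → contradiction uv (Graph.irrefl T refl) }
    }

-- Both vertices are born in one cable, so that `K`, of rank 2, supplies the edge.
IsSfw-two : (T : Graph 2) → Adj T zero (suc zero) → IsSfw T 2
IsSfw-two T 0~1 = (t₂ , legal , refl) , λ t l → Adds⇒2≤width t [] (Legal.complete l 0~1)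
  where
  t₂ : Term 2 0 0
  t₂ = ν ⊤ (zero , ∈⊤) ⨾ K ⨾ κ

  adj : ∀ u v → u ≢ v → Adj T u v
  adj zero       zero       u≢v = contradiction refl u≢v
  adj zero       (suc zero) _   = 0~1
  adj (suc zero) zero       _   = Graph.sym T 0~1
  adj (suc zero) (suc zero) u≢v = contradiction refl u≢v

  legal : Legal T t₂
  legal = record
    { bornOnce = λ { zero → refl ; (suc zero) → refl }
    ; sound    = λ { {u} {v} (inj₁ (inj₂ (u≢v , _))) → adj u v u≢v }
    ; complete = λ uv → inj₁ (inj₂ ((λ u≡v → Graph.irrefl T u≡v uv) , ∈⊤ , ∈⊤))
    }

IsSfw-many : (T : Graph (3 + n)) → IsTree T → IsSfw T 4
IsSfw-many T tree with spanning T tree | connected⇒Path₃ T (IsTree.connected tree)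
... | t , induces , all∈ | _ , _ , _ , a≢c , ab , bc =
  -- The lower bound serves twice: for minimality, and to make the width of this term exactly 4.
  (compile t ⨾ κ , legal , ≤-antisym width≤4 (lower _ legal)) , lower
  where
  legal = legal-compile t induces all∈
  lower = path₃⇒4≤width {T = T} (IsTree.acyclic tree) a≢c ab bc

  width≤4 : width (compile t ⨾ κ) ≤ 4
  width≤4 = ⊔-lub z≤n (⊔-lub (width-compile t) (s≤s z≤n))

theorem4p1 : ∀ {n : ℕ} (T : Graph n) → IsTree T → ∃[ w ] (IsSfw T w × w ≤ 4)
theorem4p1 {zero}              T tree = 0 , refl , z≤n
theorem4p1 {suc zero}          T tree = 1 , IsSfw-one T , s≤s z≤n
theorem4p1 {suc (suc zero)}    T tree with IsTree.connected tree zero (suc zero)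
-- The first step of a walk from 0 to 1 cannot be a loop, so it is the edge itself.
... | _◅_ {j = zero}     0~0 _ = contradiction 0~0 (Graph.irrefl T refl)
... | _◅_ {j = suc zero} 0~1 _ = 2 , IsSfw-two T 0~1 , s≤s (s≤s z≤n)
theorem4p1 {suc (suc (suc _))} T tree = 4 , IsSfw-many T tree , ≤-refl
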